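{- Let $\mathbf{A}=\langle A;\oplus,-,{}^{+},{}^{ - },0,1\rangle$ be a quasi-MV* algebra and let $\mathbf{W}=\langle W;\to,\neg,{}^{+},{}^{ - },1\rangle$ be a quasi-Wajsberg* algebra. Let $f(\mathbf{A})=\langle A;\to,\neg,{}^{+},{}^{ - },1\rangle$, where $x\to y:=-x\oplus y$ and $\neg x:=-x$ (the operations ${}^+,{}^-$ and the constant $1$ are those of $\mathbf{A}$), and let $g(\mathbf{W})=\langle W;\oplus,-,{}^{+},{}^{ - },0,1\rangle$, where $0:=x\to x$ (for any $x\in W$), $x\oplus y:=\neg x\to y$ and $-x:=\neg x$ (the operations ${}^+,{}^-$ and the constant $1$ are those of $\mathbf{W}$). Then $g(f(\mathbf{A}))=\mathbf{A}$ and $f(g(\mathbf{W}))=\mathbf{W}$; hence $f$ and $g$ are mutually inverse correspondences between quasi-MV* algebras and quasi-Wajsberg* algebras.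
   Context: A quasi-MV* algebra is an algebra $\langle A;\oplus,-,{}^{+},{}^{ - },0,1\rangle$ of type $\langle2,1,1,1,0,0\rangle$ such that for all $x,y,z\in A$: (QMV*1) $x\oplus y=y\oplus x$; (QMV*2) $(1\oplus x)\oplus(y\oplus(1\oplus z))=((1\oplus x)\oplus y)\oplus(1\oplus z)$; (QMV*3) $(x\oplus 1)\oplus 1=1$; (QMV*4) $(x\oplus y)\oplus 0=x\oplus y$; (QMV*5) $x^{+}\oplus 0=(x\oplus 0)^{+}=1\oplus(-1\oplus x)$ and $x^{ - }\oplus 0=(x\oplus 0)^{ - }=-1\oplus(1\oplus x)$; (QMV*6) $x\oplus y=(x^{+}\oplus y^{+})\oplus(x^{ - }\oplus y^{ - })$; (QMV*7) $0=-0$; (QMV*8) $x\oplus(-x)=0$; (QMV*9) $-(x\oplus y)=-x\oplus(-y)$; (QMV*10) $-(-x)=x$; (QMV*11) $(-x\oplus(x\oplus y))^{+}=-x^{+}\oplus(x^{+}\oplus y^{+})$; (QMV*12) $x\vee y=y\vee x$; (QMV*13) $x\vee(y\vee z)=(x\vee y)\vee z$; (QMV*14) $x\oplus(y\vee z)=(x\oplus y)\vee(x\oplus z)$; where $x\vee y:=(x^{+}\oplus(-x^{+}\oplus y^{+})^{+})\oplus(x^{ - }\oplus(-x^{ - }\oplus y^{ - })^{+})$. Here the postfix operations ${}^+,{}^-$ bind tighter than $-$, so e.g. $-x^{+}$ means $-(x^{+})$. A quasi-Wajsberg* algebra is an algebra $\langle W;\to,\neg,{}^{+},{}^{ - },1\rangle$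 of type $\langle2,1,1,1,0\rangle$ such that for all $x,y,z\in W$: (QW*1) $x\to y=\neg y\to\neg x$; (QW*2) $(x\to 1)\to((y\to 1)\to z)=(y\to 1)\to((x\to 1)\to z)$; (QW*3) $(1\to x)\to 1=1$; (QW*4) $(z\to z)\to(x\to y)=x\to y$; (QW*5) $(1\to 1)\to x^{+}=((1\to 1)\to x)^{+}=(x\to 1)\to 1$ and $(1\to 1)\to x^{ - }=((1\to 1)\to x)^{ - }=(x\to\neg 1)\to\neg 1$; (QW*6) $x\to y=(y^{+}\to x^{ - })\to(x^{+}\to y^{ - })$; (QW*7) $\neg(x\to y)=y\to x$; (QW*8) $\neg\neg x=x$; (QW*9) $(x\to(\neg x\to y))^{+}=x^{+}\to(\neg x^{+}\to y^{+})$; (QW*10) $x\vee y=y\vee x$; (QW*11) $x\vee(y\vee z)=(x\vee y)\vee z$; (QW*12) $x\to(y\vee z)=(x\to y)\vee(x\to z)$; where $x\vee y:=((x^{+}\to y^{+})^{+}\to(\neg x)^{ - })\to((y^{ - }\to x^{ - })^{ - }\to x^{ - })$. Conventions: ${}^+,{}^-$ bind tighter than $\neg$, which binds tighter than $\to$ (so $\neg x^{+}$ means $\neg(x^{+})$ and $\neg x\to y$ means $(\neg x)\to y$). In a quasi-Wajsberg* algebra $x\to x=y\to y$ for all $x,y$, so $0:=x\to x$ is well defined. -}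

module Defs where

open import Level using (Level; _⊔_)
open import Data.Product using (_×_)
open import Algebra.Definitions using (Congruent₁; Congruent₂)
open import Relation.Binary.Bundles using (Setoid)
import Relation.Binary.Construct.On as On
import Relation.Binary.Reasoning.Setoid as SetoidReasoning

private
  variable
    c ℓ : Level

-- Algebras live on an arbitrary setoid, as in the Algebra hierarchy of the
-- standard library: "equal" means equal in that setoid, and every operation is
-- required to respect it (the *-cong fields below).  Taking the setoid of
-- propositional equality gives algebras on a plain type.

record RawQuasiMV* (A : Set c) : Set c where
  infix  9 _⁺ _⁻
  infix  8 -_
  infixl 6 _⊕_
  infix  5 _∨_
  field
    _⊕_ : A → A → A
    -_  : A → A
    _⁺  : A → A
    _⁻  : A → A
    0#  : A
    1#  : A

  _∨_ : A → A → A
  x ∨ y = (x ⁺ ⊕ (- x ⁺ ⊕ y ⁺) ⁺) ⊕ (x ⁻ ⊕ (- x ⁻ ⊕ y ⁻) ⁺)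

record IsQuasiMV* (S : Setoid c ℓ) (A : RawQuasiMV* (Setoid.Carrier S)) : Set (c ⊔ ℓ) where
  open Setoid S using (_≈_)
  open RawQuasiMV* A
  field
    ⊕-cong : Congruent₂ _≈_ _⊕_
    -‿cong : Congruent₁ _≈_ -_
    ⁺-cong : Congruent₁ _≈_ _⁺
    ⁻-cong : Congruent₁ _≈_ _⁻

    QMV*1  : ∀ x y → x ⊕ y ≈ y ⊕ x
    QMV*2  : ∀ x y z → (1# ⊕ x) ⊕ (y ⊕ (1# ⊕ z)) ≈ ((1# ⊕ x) ⊕ y) ⊕ (1# ⊕ z)
    QMV*3  : ∀ x → (x ⊕ 1#) ⊕ 1# ≈ 1#
    QMV*4  : ∀ x y → (x ⊕ y) ⊕ 0# ≈ x ⊕ y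
    QMV*5⁺ : ∀ x → (x ⁺ ⊕ 0# ≈ (x ⊕ 0#) ⁺) × ((x ⊕ 0#) ⁺ ≈ 1# ⊕ (- 1# ⊕ x))
    QMV*5⁻ : ∀ x → (x ⁻ ⊕ 0# ≈ (x ⊕ 0#) ⁻) × ((x ⊕ 0#) ⁻ ≈ - 1# ⊕ (1# ⊕ x))
    QMV*6  : ∀ x y → x ⊕ y ≈ (x ⁺ ⊕ y ⁺) ⊕ (x ⁻ ⊕ y ⁻)
    QMV*7  : 0# ≈ - 0#
    QMV*8  : ∀ x → x ⊕ (- x) ≈ 0#
    QMV*9  : ∀ x y → - (x ⊕ y) ≈ - x ⊕ (- y)
    QMV*10 : ∀ x → - (- x) ≈ x
    QMV*11 : ∀ x y → (- x ⊕ (x ⊕ y)) ⁺ ≈ - x ⁺ ⊕ (x ⁺ ⊕ y ⁺)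
    QMV*12 : ∀ x y → x ∨ y ≈ y ∨ x
    QMV*13 : ∀ x y z → x ∨ (y ∨ z) ≈ (x ∨ y) ∨ z
    QMV*14 : ∀ x y z → x ⊕ (y ∨ z) ≈ (x ⊕ y) ∨ (x ⊕ z)

record QuasiMV* (S : Setoid c ℓ) : Set (c ⊔ ℓ) where
  field
    raw        : RawQuasiMV* (Setoid.Carrier S)
    isQuasiMV* : IsQuasiMV* S raw

record RawQuasiWajsberg* (W : Set c) : Set c where
  infix  9 _⁺ _⁻
  infix  8 ¬_
  infixr 6 _⇒_
  infix  5 _∨_
  field
    _⇒_ : W → W → W
    ¬_  : W → W
    _⁺  : W → W
    _⁻  : W → W
    1#  : W

  _∨_ : W → W → W
  x ∨ y = ((x ⁺ ⇒ y ⁺) ⁺ ⇒ (¬ x) ⁻) ⇒ ((y ⁻ ⇒ x ⁻) ⁻ ⇒ x ⁻)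

record IsQuasiWajsberg* (S : Setoid c ℓ) (W : RawQuasiWajsberg* (Setoid.Carrier S)) : Set (c ⊔ ℓ) where
  open Setoid S using (_≈_)
  open RawQuasiWajsberg* W
  field
    ⇒-cong : Congruent₂ _≈_ _⇒_
    ¬-cong : Congruent₁ _≈_ ¬_
    ⁺-cong : Congruent₁ _≈_ _⁺
    ⁻-cong : Congruent₁ _≈_ _⁻

    QW*1  : ∀ x y → x ⇒ y ≈ ¬ y ⇒ ¬ x
    QW*2  : ∀ x y z → (x ⇒ 1#) ⇒ ((y ⇒ 1#) ⇒ z) ≈ (y ⇒ 1#) ⇒ ((x ⇒ 1#) ⇒ z)
    QW*3  : ∀ x → (1# ⇒ x) ⇒ 1# ≈ 1#
    QW*4  : ∀ x y z → (z ⇒ z) ⇒ (x ⇒ y) ≈ x ⇒ y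
    QW*5⁺ : ∀ x → ((1# ⇒ 1#) ⇒ x ⁺ ≈ ((1# ⇒ 1#) ⇒ x) ⁺)
                × (((1# ⇒ 1#) ⇒ x) ⁺ ≈ (x ⇒ 1#) ⇒ 1#)
    QW*5⁻ : ∀ x → ((1# ⇒ 1#) ⇒ x ⁻ ≈ ((1# ⇒ 1#) ⇒ x) ⁻)
                × (((1# ⇒ 1#) ⇒ x) ⁻ ≈ (x ⇒ ¬ 1#) ⇒ ¬ 1#)
    QW*6  : ∀ x y → x ⇒ y ≈ (y ⁺ ⇒ x ⁻) ⇒ (x ⁺ ⇒ y ⁻)
    QW*7  : ∀ x y → ¬ (x ⇒ y) ≈ y ⇒ x
    QW*8  : ∀ x → ¬ (¬ x) ≈ x
    QW*9  : ∀ x y → (x ⇒ (¬ x ⇒ y)) ⁺ ≈ x ⁺ ⇒ (¬ x ⁺ ⇒ y ⁺)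
    QW*10 : ∀ x y → x ∨ y ≈ y ∨ x
    QW*11 : ∀ x y z → x ∨ (y ∨ z) ≈ (x ∨ y) ∨ z
    QW*12 : ∀ x y z → x ⇒ (y ∨ z) ≈ (x ⇒ y) ∨ (x ⇒ z)

record QuasiWajsberg* (S : Setoid c ℓ) : Set (c ⊔ ℓ) where
  field
    raw              : RawQuasiWajsberg* (Setoid.Carrier S)
    isQuasiWajsberg* : IsQuasiWajsberg* S raw

-- Equality of algebras on the same carrier is stated pointwise, as there is no
-- function extensionality.
record MV*Equal (S : Setoid c ℓ) (A B : RawQuasiMV* (Setoid.Carrier S)) : Set (c ⊔ ℓ) where
  open Setoid S using (_≈_)
  private
    module A = RawQuasiMV* A
    module B = RawQuasiMV* B
  field
    ⊕-≈ : ∀ x y → x A.⊕ y ≈ x B.⊕ y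
    -‿≈ : ∀ x → A.- x ≈ B.- x
    ⁺-≈ : ∀ x → x A.⁺ ≈ x B.⁺
    ⁻-≈ : ∀ x → x A.⁻ ≈ x B.⁻
    0-≈ : A.0# ≈ B.0#
    1-≈ : A.1# ≈ B.1#

record W*Equal (S : Setoid c ℓ) (V W : RawQuasiWajsberg* (Setoid.Carrier S)) : Set (c ⊔ ℓ) where
  open Setoid S using (_≈_)
  private
    module V = RawQuasiWajsberg* V
    module W = RawQuasiWajsberg* W
  field
    ⇒-≈ : ∀ x y → x V.⇒ y ≈ x W.⇒ y
    ¬-≈ : ∀ x → V.¬ x ≈ W.¬ x
    ⁺-≈ : ∀ x → x V.⁺ ≈ x W.⁺
    ⁻-≈ : ∀ x → x V.⁻ ≈ x W.⁻
    1-≈ : V.1# ≈ W.1#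

module _ (S : Setoid c ℓ) where
  open Setoid S using (Carrier; refl; sym; trans)

  rawMV*-setoid : Setoid c (c ⊔ ℓ)
  rawMV*-setoid = record
    { Carrier       = RawQuasiMV* Carrier
    ; _≈_           = MV*Equal S
    ; isEquivalence = record
      { refl  = record
        { ⊕-≈ = λ _ _ → refl ; -‿≈ = λ _ → refl ; ⁺-≈ = λ _ → refl
        ; ⁻-≈ = λ _ → refl ; 0-≈ = refl ; 1-≈ = refl }
      ; sym   = λ p → record
        { ⊕-≈ = λ x y → sym (⊕-≈ p x y) ; -‿≈ = λ x → sym (-‿≈ p x)
        ; ⁺-≈ = λ x → sym (⁺-≈ p x) ; ⁻-≈ = λ x → sym (⁻-≈ p x)
        ; 0-≈ = sym (0-≈ p) ; 1-≈ = sym (1-≈ p) }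
      ; trans = λ p q → record
        { ⊕-≈ = λ x y → trans (⊕-≈ p x y) (⊕-≈ q x y)
        ; -‿≈ = λ x → trans (-‿≈ p x) (-‿≈ q x)
        ; ⁺-≈ = λ x → trans (⁺-≈ p x) (⁺-≈ q x)
        ; ⁻-≈ = λ x → trans (⁻-≈ p x) (⁻-≈ q x)
        ; 0-≈ = trans (0-≈ p) (0-≈ q) ; 1-≈ = trans (1-≈ p) (1-≈ q) }
      }
    }
    where open MV*Equal

  rawW*-setoid : Setoid c (c ⊔ ℓ)
  rawW*-setoid = record
    { Carrier       = RawQuasiWajsberg* Carrier
    ; _≈_           = W*Equal S
    ; isEquivalence = record
      { refl  = record
        { ⇒-≈ = λ _ _ → refl ; ¬-≈ = λ _ → refl ; ⁺-≈ = λ _ → refl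
        ; ⁻-≈ = λ _ → refl ; 1-≈ = refl }
      ; sym   = λ p → record
        { ⇒-≈ = λ x y → sym (⇒-≈ p x y) ; ¬-≈ = λ x → sym (¬-≈ p x)
        ; ⁺-≈ = λ x → sym (⁺-≈ p x) ; ⁻-≈ = λ x → sym (⁻-≈ p x)
        ; 1-≈ = sym (1-≈ p) }
      ; trans = λ p q → record
        { ⇒-≈ = λ x y → trans (⇒-≈ p x y) (⇒-≈ q x y)
        ; ¬-≈ = λ x → trans (¬-≈ p x) (¬-≈ q x)
        ; ⁺-≈ = λ x → trans (⁺-≈ p x) (⁺-≈ q x)
        ; ⁻-≈ = λ x → trans (⁻-≈ p x) (⁻-≈ q x)
        ; 1-≈ = trans (1-≈ p) (1-≈ q) }
      }
    }
    where open W*Equal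

QuasiMV*-setoid : Setoid c ℓ → Setoid (c ⊔ ℓ) (c ⊔ ℓ)
QuasiMV*-setoid S = On.setoid (rawMV*-setoid S) (QuasiMV*.raw {S = S})

QuasiWajsberg*-setoid : Setoid c ℓ → Setoid (c ⊔ ℓ) (c ⊔ ℓ)
QuasiWajsberg*-setoid S = On.setoid (rawW*-setoid S) (QuasiWajsberg*.raw {S = S})

f : {A : Set c} → RawQuasiMV* A → RawQuasiWajsberg* A
f A = record
  { _⇒_ = λ x y → - x ⊕ y
  ; ¬_  = -_
  ; _⁺  = _⁺
  ; _⁻  = _⁻
  ; 1#  = 1#
  }
  where open RawQuasiMV* A

-- 0 is x ⇒ x for any x; 1# is the x chosen here, and ⇒-self shows that the
-- choice is immaterial.
g : {W : Set c} → RawQuasiWajsberg* W → RawQuasiMV* W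
g W = record
  { _⊕_ = λ x y → ¬ x ⇒ y
  ; -_  = ¬_
  ; _⁺  = _⁺
  ; _⁻  = _⁻
  ; 0#  = 1# ⇒ 1#
  ; 1#  = 1#
  }
  where open RawQuasiWajsberg* W

module _ {S : Setoid c ℓ} {W : RawQuasiWajsberg* (Setoid.Carrier S)}
         (isQW* : IsQuasiWajsberg* S W) where
  open Setoid S using (_≈_)
  open RawQuasiWajsberg* W
  open IsQuasiWajsberg* isQW*
  open SetoidReasoning S

  ⇒-self : ∀ x y → x ⇒ x ≈ y ⇒ y
  ⇒-self x y = begin
    x ⇒ x                      ≈⟨ QW*4 x x y ⟨
    (y ⇒ y) ⇒ (x ⇒ x)          ≈⟨ QW*1 (y ⇒ y) (x ⇒ x) ⟩
    ¬ (x ⇒ x) ⇒ ¬ (y ⇒ y)      ≈⟨ ⇒-cong (QW*7 x x) (QW*7 y y) ⟩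
    (x ⇒ x) ⇒ (y ⇒ y)          ≈⟨ QW*4 y y x ⟩
    y ⇒ y                      ∎

{-# OPTIONS --safe #-}

-- The translations are term-by-term except for the axioms on positive and
-- negative parts (QMV*6 against QW*6) and for the two joins; there one side has
-- (- x)⁺ and the other - x⁻.  These two terms need not be equal, but they are
-- after adding 0.  This suffices because addition does not see whether 0 was
-- added to a summand: x ∨ x = x ⊕ 0, so distributivity over ∨ gives
-- x ⊕ (y ⊕ 0) = (x ⊕ y) ∨ (x ⊕ y) = (x ⊕ y) ⊕ 0 = x ⊕ y.
module Submission where

open import Defs
open import Level using (Level; _⊔_)
open import Data.Product using (_×_; Σ-syntax; _,_; proj₁; proj₂)
open import Function.Bundles using (Inverse)
open import Relation.Binary.Bundles using (Setoid)
open import Relation.Binary.PropositionalEquality using (_≡_)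
import Relation.Binary.PropositionalEquality as ≡
open import Algebra.Definitions using (Congruent₁; Congruent₂)
import Relation.Binary.Reasoning.Setoid as SetoidReasoning

private
  variable
    c ℓ : Level

-- These axioms transfer to g W without knowing that x ⊕ (y ⊕ 0) ≈ x ⊕ y, and
-- they suffice for comparing (- x)⁺ with - x⁻ up to adding 0.
record IsPreQuasiMV* (S : Setoid c ℓ) (A : RawQuasiMV* (Setoid.Carrier S)) : Set (c ⊔ ℓ) where
  open Setoid S using (_≈_)
  open RawQuasiMV* A
  field
    ⊕-cong       : Congruent₂ _≈_ _⊕_
    -‿cong       : Congruent₁ _≈_ -_
    ⁺-cong       : Congruent₁ _≈_ _⁺
    ⁻-cong       : Congruent₁ _≈_ _⁻
    ⊕-comm       : ∀ x y → x ⊕ y ≈ y ⊕ x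
    ⊕-absorb-1   : ∀ x → (x ⊕ 1#) ⊕ 1# ≈ 1#
    ⊕-⊕0         : ∀ x y → (x ⊕ y) ⊕ 0# ≈ x ⊕ y
    ⁺-⊕0         : ∀ x → x ⁺ ⊕ 0# ≈ (x ⊕ 0#) ⁺
    ⊕0-⁺         : ∀ x → (x ⊕ 0#) ⁺ ≈ 1# ⊕ (- 1# ⊕ x)
    ⁻-⊕0         : ∀ x → x ⁻ ⊕ 0# ≈ (x ⊕ 0#) ⁻
    ⊕0-⁻         : ∀ x → (x ⊕ 0#) ⁻ ≈ - 1# ⊕ (1# ⊕ x)
    0≈-0         : 0# ≈ - 0#
    ⊕-inverseʳ   : ∀ x → x ⊕ (- x) ≈ 0#
    -‿distrib-⊕  : ∀ x y → - (x ⊕ y) ≈ - x ⊕ (- y)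
    -‿involutive : ∀ x → - (- x) ≈ x

-- Zero, negation and the positive and negative parts.

module PreQuasiMV*Properties {S : Setoid c ℓ} {A : RawQuasiMV* (Setoid.Carrier S)}
                             (isPre : IsPreQuasiMV* S A) where
  open Setoid S
  open RawQuasiMV* A
  open IsPreQuasiMV* isPre
  open SetoidReasoning S

  ⊕-congˡ : ∀ {x y z} → y ≈ z → x ⊕ y ≈ x ⊕ z
  ⊕-congˡ = ⊕-cong refl

  ⊕-congʳ : ∀ {x y z} → y ≈ z → y ⊕ x ≈ z ⊕ x
  ⊕-congʳ p = ⊕-cong p refl

  ⊕-inverseˡ : ∀ x → - x ⊕ x ≈ 0#
  ⊕-inverseˡ x = trans (⊕-comm (- x) x) (⊕-inverseʳ x)

  -‿flip : ∀ x y → - (- x ⊕ y) ≈ - y ⊕ x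
  -‿flip x y = begin
    - (- x ⊕ y)      ≈⟨ -‿distrib-⊕ (- x) y ⟩
    - (- x) ⊕ - y    ≈⟨ ⊕-congʳ (-‿involutive x) ⟩
    x ⊕ - y          ≈⟨ ⊕-comm x (- y) ⟩
    - y ⊕ x          ∎

  -‿⊕0 : ∀ x → - (x ⊕ 0#) ≈ - x ⊕ 0#
  -‿⊕0 x = trans (-‿distrib-⊕ x 0#) (⊕-congˡ (sym 0≈-0))

  0⊕0 : 0# ⊕ 0# ≈ 0#
  0⊕0 = trans (⊕-congˡ 0≈-0) (⊕-inverseʳ 0#)

  -- By `⊕-absorb-1` the constant 1 is itself a sum, and sums absorb 0.
  1⊕0 : 1# ⊕ 0# ≈ 1#
  1⊕0 = begin
    1# ⊕ 0#                  ≈⟨ ⊕-congʳ (⊕-absorb-1 0#) ⟨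
    ((0# ⊕ 1#) ⊕ 1#) ⊕ 0#    ≈⟨ ⊕-⊕0 (0# ⊕ 1#) 1# ⟩
    (0# ⊕ 1#) ⊕ 1#           ≈⟨ ⊕-absorb-1 0# ⟩
    1#                       ∎

  0⁺ : 0# ⁺ ≈ 0#
  0⁺ = begin
    -- The formula `⊕0-⁺` speaks only of elements `x ⊕ 0#`, so 0 is first written in that form.
    0# ⁺                  ≈⟨ ⁺-cong 0⊕0 ⟨
    (0# ⊕ 0#) ⁺           ≈⟨ ⊕0-⁺ 0# ⟩
    1# ⊕ (- 1# ⊕ 0#)      ≈⟨ ⊕-congˡ (-‿⊕0 1#) ⟨
    1# ⊕ (- (1# ⊕ 0#))    ≈⟨ ⊕-congˡ (-‿cong 1⊕0) ⟩
    1# ⊕ (- 1#)           ≈⟨ ⊕-inverseʳ 1# ⟩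
    0#                    ∎

  0⁻ : 0# ⁻ ≈ 0#
  0⁻ = begin
    0# ⁻                  ≈⟨ ⁻-cong 0⊕0 ⟨
    (0# ⊕ 0#) ⁻           ≈⟨ ⊕0-⁻ 0# ⟩
    - 1# ⊕ (1# ⊕ 0#)      ≈⟨ ⊕-congˡ 1⊕0 ⟩
    - 1# ⊕ 1#             ≈⟨ ⊕-inverseˡ 1# ⟩
    0#                    ∎

  -- The explicit formulas for the two parts, `⊕0-⁺` and `⊕0-⁻`, are mirror images under negation.
  -‿⁺ : ∀ x → (- x) ⁺ ⊕ 0# ≈ - x ⁻ ⊕ 0#
  -‿⁺ x = begin
    (- x) ⁺ ⊕ 0#                 ≈⟨ ⁺-⊕0 (- x) ⟩
    (- x ⊕ 0#) ⁺                 ≈⟨ ⊕0-⁺ (- x) ⟩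
    1# ⊕ (- 1# ⊕ - x)            ≈⟨ ⊕-cong (-‿involutive 1#) (-‿distrib-⊕ 1# x) ⟨
    - (- 1#) ⊕ - (1# ⊕ x)        ≈⟨ -‿distrib-⊕ (- 1#) (1# ⊕ x) ⟨
    - (- 1# ⊕ (1# ⊕ x))          ≈⟨ -‿cong (⊕0-⁻ x) ⟨
    - (x ⊕ 0#) ⁻                 ≈⟨ -‿cong (⁻-⊕0 x) ⟨
    - (x ⁻ ⊕ 0#)                 ≈⟨ -‿⊕0 (x ⁻) ⟩
    - x ⁻ ⊕ 0#                   ∎

  -‿⁻ : ∀ x → (- x) ⁻ ⊕ 0# ≈ - x ⁺ ⊕ 0#
  -‿⁻ x = begin
    (- x) ⁻ ⊕ 0#                 ≈⟨ ⊕-congʳ (-‿involutive ((- x) ⁻)) ⟨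
    - (- (- x) ⁻) ⊕ 0#           ≈⟨ -‿⊕0 (- (- x) ⁻) ⟨
    - (- (- x) ⁻ ⊕ 0#)           ≈⟨ -‿cong (-‿⁺ (- x)) ⟨
    - ((- (- x)) ⁺ ⊕ 0#)         ≈⟨ -‿cong (⊕-congʳ (⁺-cong (-‿involutive x))) ⟩
    - (x ⁺ ⊕ 0#)                 ≈⟨ -‿⊕0 (x ⁺) ⟩
    - x ⁺ ⊕ 0#                   ∎

  -- `⊕-⊕0ʳ` is a parameter because each side derives it from its own distributive law. On the
  -- Wajsberg side it must be available before `g W` is known to be a quasi-MV* algebra.
  module _ (⊕-⊕0ʳ : ∀ x y → x ⊕ (y ⊕ 0#) ≈ x ⊕ y) where

    private
      module fA = RawQuasiWajsberg* (f A)

    -- Makes `-‿⁺` and `-‿⁻`, which are equalities with 0 added, applicable inside a sum.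
    ⊕-congˡ-mod0 : ∀ x {y z} → y ⊕ 0# ≈ z ⊕ 0# → x ⊕ y ≈ x ⊕ z
    ⊕-congˡ-mod0 x {y} {z} p = begin
      x ⊕ y           ≈⟨ ⊕-⊕0ʳ x y ⟨
      x ⊕ (y ⊕ 0#)    ≈⟨ ⊕-congˡ p ⟩
      x ⊕ (z ⊕ 0#)    ≈⟨ ⊕-⊕0ʳ x z ⟩
      x ⊕ z           ∎

    ⊕-congʳ-mod0 : ∀ x {y z} → y ⊕ 0# ≈ z ⊕ 0# → y ⊕ x ≈ z ⊕ x
    ⊕-congʳ-mod0 x {y} {z} p =
      trans (⊕-comm y x) (trans (⊕-congˡ-mod0 x p) (⊕-comm x z))

    -- Matches the right side of QW*6 with that of QMV*6 at `- x` and `y`; both directions use it.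
    f-parts : ∀ x y → (y ⁺ fA.⇒ x ⁻) fA.⇒ (x ⁺ fA.⇒ y ⁻)
                    ≈ ((- x) ⁺ ⊕ y ⁺) ⊕ ((- x) ⁻ ⊕ y ⁻)
    f-parts x y = begin
      - (- y ⁺ ⊕ x ⁻) ⊕ (- x ⁺ ⊕ y ⁻)      ≈⟨ ⊕-congʳ (-‿flip (y ⁺) (x ⁻)) ⟩
      (- x ⁻ ⊕ y ⁺) ⊕ (- x ⁺ ⊕ y ⁻)        ≈⟨ ⊕-cong (⊕-congʳ-mod0 (y ⁺) (-‿⁺ x))
                                                    (⊕-congʳ-mod0 (y ⁻) (-‿⁻ x)) ⟨
      ((- x) ⁺ ⊕ y ⁺) ⊕ ((- x) ⁻ ⊕ y ⁻)    ∎

    -- Each join is a sum of a positive and a negative summand, and these agree separately. All join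
    -- axioms, in both directions, transfer through this lemma.
    f-∨ : ∀ x y → x fA.∨ y ≈ x ∨ y
    f-∨ x y = ⊕-cong pos neg
      where
      u = (- x ⁺ ⊕ y ⁺) ⁺
      v = - y ⁻ ⊕ x ⁻

      pos : - (- u ⊕ (- x) ⁻) ≈ x ⁺ ⊕ u
      pos = begin
        - (- u ⊕ (- x) ⁻)      ≈⟨ -‿flip u ((- x) ⁻) ⟩
        - (- x) ⁻ ⊕ u          ≈⟨ ⊕-congʳ-mod0 u (-‿⁺ (- x)) ⟨
        (- (- x)) ⁺ ⊕ u        ≈⟨ ⊕-congʳ (⁺-cong (-‿involutive x)) ⟩
        x ⁺ ⊕ u                ∎

      neg : - v ⁻ ⊕ x ⁻ ≈ x ⁻ ⊕ (- x ⁻ ⊕ y ⁻) ⁺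
      neg = begin
        - v ⁻ ⊕ x ⁻                  ≈⟨ ⊕-comm (- v ⁻) (x ⁻) ⟩
        -- `- v` is the difference `- x ⁻ ⊕ y ⁻` in the other join, so negation turns the negative
        -- part of `v` into the positive part wanted there.
        x ⁻ ⊕ - v ⁻                  ≈⟨ ⊕-congˡ-mod0 (x ⁻) (-‿⁺ v) ⟨
        x ⁻ ⊕ (- v) ⁺                ≈⟨ ⊕-congˡ (⁺-cong (-‿flip (y ⁻) (x ⁻))) ⟩
        x ⁻ ⊕ (- x ⁻ ⊕ y ⁻) ⁺        ∎

-- From quasi-MV* algebras to quasi-Wajsberg* algebras.

module QuasiMV*Properties {S : Setoid c ℓ} {A : RawQuasiMV* (Setoid.Carrier S)}
                          (isQMV* : IsQuasiMV* S A) where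
  open Setoid S
  open RawQuasiMV* A
  open IsQuasiMV* isQMV*
  open SetoidReasoning S

  isPreQuasiMV* : IsPreQuasiMV* S A
  isPreQuasiMV* = record
    { ⊕-cong       = ⊕-cong
    ; -‿cong       = -‿cong
    ; ⁺-cong       = ⁺-cong
    ; ⁻-cong       = ⁻-cong
    ; ⊕-comm       = QMV*1
    ; ⊕-absorb-1   = QMV*3
    ; ⊕-⊕0         = QMV*4
    ; ⁺-⊕0         = λ x → proj₁ (QMV*5⁺ x)
    ; ⊕0-⁺         = λ x → proj₂ (QMV*5⁺ x)
    ; ⁻-⊕0         = λ x → proj₁ (QMV*5⁻ x)
    ; ⊕0-⁻         = λ x → proj₂ (QMV*5⁻ x)
    ; 0≈-0         = QMV*7
    ; ⊕-inverseʳ   = QMV*8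
    ; -‿distrib-⊕  = QMV*9
    ; -‿involutive = QMV*10
    }

  open PreQuasiMV*Properties isPreQuasiMV*

  ∨-cong : Congruent₂ _≈_ _∨_
  ∨-cong p q = ⊕-cong
    (⊕-cong (⁺-cong p) (⁺-cong (⊕-cong (-‿cong (⁺-cong p)) (⁺-cong q))))
    (⊕-cong (⁻-cong p) (⁺-cong (⊕-cong (-‿cong (⁻-cong p)) (⁻-cong q))))

  -- Both inner differences vanish. Since 0 is its own positive and negative part, what remains is
  -- the decomposition of `x ⊕ 0#` by QMV*6.
  ∨-self : ∀ x → x ∨ x ≈ x ⊕ 0#
  ∨-self x = begin
    x ∨ x                               ≈⟨ ⊕-cong (⊕-congˡ (⁺-cong (⊕-inverseˡ (x ⁺))))
                                                  (⊕-congˡ (⁺-cong (⊕-inverseˡ (x ⁻)))) ⟩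
    (x ⁺ ⊕ 0# ⁺) ⊕ (x ⁻ ⊕ 0# ⁺)         ≈⟨ ⊕-congˡ (⊕-congˡ (trans 0⁺ (sym 0⁻))) ⟩
    (x ⁺ ⊕ 0# ⁺) ⊕ (x ⁻ ⊕ 0# ⁻)         ≈⟨ QMV*6 x 0# ⟨
    x ⊕ 0#                              ∎

  ⊕-⊕0ʳ : ∀ x y → x ⊕ (y ⊕ 0#) ≈ x ⊕ y
  ⊕-⊕0ʳ x y = begin
    x ⊕ (y ⊕ 0#)         ≈⟨ ⊕-congˡ (∨-self y) ⟨
    x ⊕ (y ∨ y)          ≈⟨ QMV*14 x y y ⟩
    (x ⊕ y) ∨ (x ⊕ y)    ≈⟨ ∨-self (x ⊕ y) ⟩
    (x ⊕ y) ⊕ 0#         ≈⟨ QMV*4 x y ⟩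
    x ⊕ y                ∎

  -- Commutativity turns the restricted associativity QMV*2 into an exchange law, which is the shape
  -- of QW*2.
  ⊕-1-exchange : ∀ x y z → (1# ⊕ x) ⊕ ((1# ⊕ y) ⊕ z) ≈ (1# ⊕ y) ⊕ ((1# ⊕ x) ⊕ z)
  ⊕-1-exchange x y z = begin
    (1# ⊕ x) ⊕ ((1# ⊕ y) ⊕ z)    ≈⟨ ⊕-congˡ (QMV*1 (1# ⊕ y) z) ⟩
    (1# ⊕ x) ⊕ (z ⊕ (1# ⊕ y))    ≈⟨ QMV*2 x z y ⟩
    ((1# ⊕ x) ⊕ z) ⊕ (1# ⊕ y)    ≈⟨ QMV*1 ((1# ⊕ x) ⊕ z) (1# ⊕ y) ⟩
    (1# ⊕ y) ⊕ ((1# ⊕ x) ⊕ z)    ∎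

  private
    module fA = RawQuasiWajsberg* (f A)

  -- With all negations collected outside, QW*2 becomes `⊕-1-exchange` at the negated arguments.
  ⇒1-⇒1-⇒ : ∀ x y z → (x fA.⇒ 1#) fA.⇒ ((y fA.⇒ 1#) fA.⇒ z)
                    ≈ - ((1# ⊕ - x) ⊕ ((1# ⊕ - y) ⊕ - z))
  ⇒1-⇒1-⇒ x y z = begin
    - (- x ⊕ 1#) ⊕ (- (- y ⊕ 1#) ⊕ z)           ≈⟨ ⊕-cong (-‿cong (QMV*1 (- x) 1#))
                                                    (⊕-cong (-‿cong (QMV*1 (- y) 1#)) (sym (QMV*10 z))) ⟩
    - (1# ⊕ - x) ⊕ (- (1# ⊕ - y) ⊕ - (- z))     ≈⟨ ⊕-congˡ (QMV*9 (1# ⊕ - y) (- z)) ⟨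
    - (1# ⊕ - x) ⊕ - ((1# ⊕ - y) ⊕ - z)         ≈⟨ QMV*9 (1# ⊕ - x) ((1# ⊕ - y) ⊕ - z) ⟨
    - ((1# ⊕ - x) ⊕ ((1# ⊕ - y) ⊕ - z))         ∎

  ⇒-self-0 : ∀ x → - (- x ⊕ x) ≈ 0#
  ⇒-self-0 x = trans (-‿cong (⊕-inverseˡ x)) (sym QMV*7)

  0-⇒ : ∀ x → - (- 1# ⊕ 1#) ⊕ x ≈ x ⊕ 0#
  0-⇒ x = trans (⊕-congʳ (⇒-self-0 1#)) (QMV*1 0# x)

  f-isQuasiWajsberg* : IsQuasiWajsberg* S (f A)
  f-isQuasiWajsberg* = record
    { ⇒-cong = λ p q → ⊕-cong (-‿cong p) q
    ; ¬-cong = -‿cong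
    ; ⁺-cong = ⁺-cong
    ; ⁻-cong = ⁻-cong
    ; QW*1  = λ x y → trans (QMV*1 (- x) y) (⊕-congʳ (sym (QMV*10 y)))
    ; QW*2  = λ x y z → trans (⇒1-⇒1-⇒ x y z)
                (trans (-‿cong (⊕-1-exchange (- x) (- y) (- z))) (sym (⇒1-⇒1-⇒ y x z)))
    ; QW*3  = λ x → trans (⊕-congʳ (-‿flip 1# x)) (QMV*3 (- x))
    ; QW*4  = λ x y z → trans (⊕-congʳ (⇒-self-0 z))
                (trans (QMV*1 0# (- x ⊕ y)) (QMV*4 (- x) y))
    ; QW*5⁺ = λ x → trans (0-⇒ (x ⁺)) (trans (proj₁ (QMV*5⁺ x)) (⁺-cong (sym (0-⇒ x))))
                , (begin
                     (- (- 1# ⊕ 1#) ⊕ x) ⁺    ≈⟨ ⁺-cong (0-⇒ x) ⟩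
                     (x ⊕ 0#) ⁺               ≈⟨ proj₂ (QMV*5⁺ x) ⟩
                     1# ⊕ (- 1# ⊕ x)          ≈⟨ QMV*1 1# (- 1# ⊕ x) ⟩
                     (- 1# ⊕ x) ⊕ 1#          ≈⟨ ⊕-congʳ (-‿flip x 1#) ⟨
                     - (- x ⊕ 1#) ⊕ 1#        ∎)
    ; QW*5⁻ = λ x → trans (0-⇒ (x ⁻)) (trans (proj₁ (QMV*5⁻ x)) (⁻-cong (sym (0-⇒ x))))
                , (begin
                     (- (- 1# ⊕ 1#) ⊕ x) ⁻      ≈⟨ ⁻-cong (0-⇒ x) ⟩
                     (x ⊕ 0#) ⁻                 ≈⟨ proj₂ (QMV*5⁻ x) ⟩
                     - 1# ⊕ (1# ⊕ x)            ≈⟨ QMV*1 (- 1#) (1# ⊕ x) ⟩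
                     (1# ⊕ x) ⊕ - 1#            ≈⟨ ⊕-congʳ (⊕-congʳ (QMV*10 1#)) ⟨
                     (- (- 1#) ⊕ x) ⊕ - 1#      ≈⟨ ⊕-congʳ (-‿flip x (- 1#)) ⟨
                     - (- x ⊕ - 1#) ⊕ - 1#      ∎)
    ; QW*6  = λ x y → trans (QMV*6 (- x) y) (sym (f-parts ⊕-⊕0ʳ x y))
    ; QW*7  = -‿flip
    ; QW*8  = QMV*10
    ; QW*9  = λ x y → trans (⁺-cong (⊕-congˡ (⊕-congʳ (QMV*10 x))))
                (trans (QMV*11 x y) (⊕-congˡ (⊕-congʳ (sym (QMV*10 (x ⁺))))))
    ; QW*10 = λ x y → trans (join x y) (trans (QMV*12 x y) (sym (join y x)))
    ; QW*11 = λ x y z → begin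
                x fA.∨ (y fA.∨ z)    ≈⟨ join x (y fA.∨ z) ⟩
                x ∨ (y fA.∨ z)       ≈⟨ ∨-cong refl (join y z) ⟩
                x ∨ (y ∨ z)          ≈⟨ QMV*13 x y z ⟩
                (x ∨ y) ∨ z          ≈⟨ ∨-cong (join x y) refl ⟨
                (x fA.∨ y) ∨ z       ≈⟨ join (x fA.∨ y) z ⟨
                (x fA.∨ y) fA.∨ z    ∎
    ; QW*12 = λ x y z → trans (⊕-congˡ (join y z))
                (trans (QMV*14 (- x) y z) (sym (join (- x ⊕ y) (- x ⊕ z))))
    }
    where
    join : ∀ x y → x fA.∨ y ≈ x ∨ y
    join = f-∨ ⊕-⊕0ʳ

  g∘f : MV*Equal S (g (f A)) A
  g∘f = record
    { ⊕-≈ = λ x y → ⊕-congʳ (QMV*10 x)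
    ; -‿≈ = λ x → refl
    ; ⁺-≈ = λ x → refl
    ; ⁻-≈ = λ x → refl
    ; 0-≈ = ⊕-inverseˡ 1#
    ; 1-≈ = refl
    }

-- From quasi-Wajsberg* algebras to quasi-MV* algebras.

module QuasiWajsberg*Properties {S : Setoid c ℓ} {W : RawQuasiWajsberg* (Setoid.Carrier S)}
                                (isQW* : IsQuasiWajsberg* S W) where
  open Setoid S
  open RawQuasiWajsberg* W
  open IsQuasiWajsberg* isQW*
  open SetoidReasoning S
  open RawQuasiMV* (g W) using (_⊕_; 0#) renaming (_∨_ to _∨ᵍ_)

  ⇒-congˡ : ∀ {x y z} → y ≈ z → x ⇒ y ≈ x ⇒ z
  ⇒-congˡ = ⇒-cong refl

  ⇒-congʳ : ∀ {x y z} → y ≈ z → y ⇒ x ≈ z ⇒ x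
  ⇒-congʳ p = ⇒-cong p refl

  ¬¬-⇒ : ∀ x y → ¬ (¬ x) ⇒ y ≈ x ⇒ y
  ¬¬-⇒ x y = ⇒-congʳ (QW*8 x)

  ⊕-comm : ∀ x y → x ⊕ y ≈ y ⊕ x
  ⊕-comm x y = trans (QW*1 (¬ x) y) (⇒-congˡ (QW*8 x))

  -- QW*7 makes `1# ⇒ 1#` its own negation. This translates adding 0 into the prefix `0# ⇒` of QW*4
  -- and QW*5.
  ⊕0 : ∀ x → x ⊕ 0# ≈ 0# ⇒ x
  ⊕0 x = trans (⊕-comm x 0#) (⇒-congʳ (QW*7 1# 1#))

  ¬-distrib-⊕ : ∀ x y → ¬ (x ⊕ y) ≈ (¬ x) ⊕ (¬ y)
  ¬-distrib-⊕ x y = trans (QW*7 (¬ x) y) (QW*1 y (¬ x))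

  ¬-⇒-1 : ∀ x → ¬ (x ⇒ 1#) ≈ (¬ 1#) ⊕ x
  ¬-⇒-1 x = trans (QW*7 x 1#) (sym (¬¬-⇒ 1# x))

  -- Opens the comparison lemmas for `g W` while QMV*6 and the join axioms are still to be proved.
  g-isPreQuasiMV* : IsPreQuasiMV* S (g W)
  g-isPreQuasiMV* = record
    { ⊕-cong       = λ p q → ⇒-cong (¬-cong p) q
    ; -‿cong       = ¬-cong
    ; ⁺-cong       = ⁺-cong
    ; ⁻-cong       = ⁻-cong
    ; ⊕-comm       = ⊕-comm
    ; ⊕-absorb-1   = λ x → trans (⇒-congʳ (QW*7 (¬ x) 1#)) (QW*3 (¬ x))
    ; ⊕-⊕0         = λ x y → trans (⊕0 (x ⊕ y)) (QW*4 (¬ x) y 1#)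
    ; ⁺-⊕0         = λ x → trans (⊕0 (x ⁺)) (trans (proj₁ (QW*5⁺ x)) (⁺-cong (sym (⊕0 x))))
    ; ⊕0-⁺         = λ x → begin
                       (x ⊕ 0#) ⁺             ≈⟨ ⁺-cong (⊕0 x) ⟩
                       (0# ⇒ x) ⁺             ≈⟨ proj₂ (QW*5⁺ x) ⟩
                       (x ⇒ 1#) ⇒ 1#          ≈⟨ QW*1 (x ⇒ 1#) 1# ⟩
                       1# ⊕ ¬ (x ⇒ 1#)        ≈⟨ ⇒-congˡ (¬-⇒-1 x) ⟩
                       1# ⊕ ((¬ 1#) ⊕ x)      ∎
    ; ⁻-⊕0         = λ x → trans (⊕0 (x ⁻)) (trans (proj₁ (QW*5⁻ x)) (⁻-cong (sym (⊕0 x))))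
    ; ⊕0-⁻         = λ x → begin
                       (x ⊕ 0#) ⁻                 ≈⟨ ⁻-cong (⊕0 x) ⟩
                       (0# ⇒ x) ⁻                 ≈⟨ proj₂ (QW*5⁻ x) ⟩
                       (x ⇒ ¬ 1#) ⇒ ¬ 1#          ≈⟨ QW*1 (x ⇒ ¬ 1#) (¬ 1#) ⟩
                       (¬ 1#) ⊕ ¬ (x ⇒ ¬ 1#)      ≈⟨ ⇒-congˡ (QW*7 x (¬ 1#)) ⟩
                       (¬ 1#) ⊕ (1# ⊕ x)          ∎
    ; 0≈-0         = sym (QW*7 1# 1#)
    -- The sum unfolds to `¬ x ⇒ ¬ x`.
    ; ⊕-inverseʳ   = λ x → ⇒-self isQW* (¬ x) 1#
    ; -‿distrib-⊕  = ¬-distrib-⊕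
    ; -‿involutive = QW*8
    }

  open PreQuasiMV*Properties g-isPreQuasiMV*
    using (0⁺; 0⁻; -‿⁻; f-parts; f-∨; ⊕-congˡ; ⊕-congʳ)

  -- Both inner self-implications are 0; the rest is reshaped into the right side of QW*6 at `0#`
  -- and `x`.
  ∨-self : ∀ x → x ∨ x ≈ 0# ⇒ x
  ∨-self x = begin
    x ∨ x                                        ≈⟨ ⇒-cong (⇒-congʳ (⁺-cong (⇒-self isQW* (x ⁺) 1#)))
                                                           (⇒-congʳ (⁻-cong (⇒-self isQW* (x ⁻) 1#))) ⟩
    (0# ⁺ ⇒ (¬ x) ⁻) ⇒ (0# ⁻ ⇒ x ⁻)              ≈⟨ ⇒-cong pos (⇒-congʳ (trans 0⁻ (sym 0⁺))) ⟩
    (x ⁺ ⇒ 0# ⁻) ⇒ (0# ⁺ ⇒ x ⁻)                  ≈⟨ QW*6 0# x ⟨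
    0# ⇒ x                                       ∎
    where
    pos : 0# ⁺ ⇒ (¬ x) ⁻ ≈ x ⁺ ⇒ 0# ⁻
    pos = begin
      0# ⁺ ⇒ (¬ x) ⁻      ≈⟨ ⇒-congʳ 0⁺ ⟩
      0# ⇒ (¬ x) ⁻        ≈⟨ ⊕0 ((¬ x) ⁻) ⟨
      -- The 0 that `-‿⁻` calls for is already present. This avoids a circle, because `⊕-⊕0ʳ` is
      -- derived from `∨-self`.
      (¬ x) ⁻ ⊕ 0#        ≈⟨ -‿⁻ x ⟩
      (¬ x ⁺) ⊕ 0#        ≈⟨ ¬¬-⇒ (x ⁺) 0# ⟩
      x ⁺ ⇒ 0#            ≈⟨ ⇒-congˡ 0⁻ ⟨
      x ⁺ ⇒ 0# ⁻          ∎

  ⊕-⊕0ʳ : ∀ x y → x ⊕ (y ⊕ 0#) ≈ x ⊕ y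
  ⊕-⊕0ʳ x y = begin
    ¬ x ⇒ (y ⊕ 0#)           ≈⟨ ⇒-congˡ (⊕0 y) ⟩
    ¬ x ⇒ (0# ⇒ y)           ≈⟨ ⇒-congˡ (∨-self y) ⟨
    ¬ x ⇒ (y ∨ y)            ≈⟨ QW*12 (¬ x) y y ⟩
    (¬ x ⇒ y) ∨ (¬ x ⇒ y)    ≈⟨ ∨-self (¬ x ⇒ y) ⟩
    0# ⇒ (¬ x ⇒ y)           ≈⟨ QW*4 (¬ x) y 1# ⟩
    ¬ x ⇒ y                  ∎

  ∨-cong : Congruent₂ _≈_ _∨_
  ∨-cong p q = ⇒-cong
    (⇒-cong (⁺-cong (⇒-cong (⁺-cong p) (⁺-cong q))) (⁻-cong (¬-cong p)))
    (⇒-cong (⁻-cong (⇒-cong (⁻-cong q) (⁻-cong p))) (⁻-cong p))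

  -- `f-∨` over `g W` leads to the join of `f (g W)`, which differs from that of `W` only by double
  -- negations.
  g-∨ : ∀ x y → x ∨ᵍ y ≈ x ∨ y
  g-∨ x y = trans (sym (f-∨ ⊕-⊕0ʳ x y))
    (⇒-¬¬ (⇒-¬¬ (⁺-cong (¬¬-⇒ (x ⁺) (y ⁺))) refl)
          (⇒-¬¬ (⁻-cong (¬¬-⇒ (y ⁻) (x ⁻))) refl))
    where
    ⇒-¬¬ : ∀ {a b c d} → a ≈ b → c ≈ d → ¬ (¬ a) ⇒ c ≈ b ⇒ d
    ⇒-¬¬ {a} {c = c} p q = trans (¬¬-⇒ a c) (⇒-cong p q)

  ⊕-parts : ∀ x y → x ⊕ y ≈ (x ⁺ ⊕ y ⁺) ⊕ (x ⁻ ⊕ y ⁻)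
  ⊕-parts x y = begin
    ¬ x ⇒ y                                                  ≈⟨ QW*6 (¬ x) y ⟩
    -- Double negations are inserted in the antecedents, giving the implications of `f (g W)` to
    -- which `f-parts` applies.
    (y ⁺ ⇒ (¬ x) ⁻) ⇒ ((¬ x) ⁺ ⇒ y ⁻)                        ≈⟨ ⇒-cong (¬¬-⇒ (y ⁺) _) (¬¬-⇒ _ (y ⁻)) ⟨
    (¬ (¬ y ⁺) ⇒ (¬ x) ⁻) ⇒ (¬ (¬ (¬ x) ⁺) ⇒ y ⁻)            ≈⟨ ¬¬-⇒ _ _ ⟨
    ¬ (¬ (¬ (¬ y ⁺) ⇒ (¬ x) ⁻)) ⇒ (¬ (¬ (¬ x) ⁺) ⇒ y ⁻)      ≈⟨ f-parts ⊕-⊕0ʳ (¬ x) y ⟩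
    ((¬ (¬ x)) ⁺ ⊕ y ⁺) ⊕ ((¬ (¬ x)) ⁻ ⊕ y ⁻)                ≈⟨ ⊕-congˡ (⊕-congʳ (⁻-cong (QW*8 x))) ⟩
    ((¬ (¬ x)) ⁺ ⊕ y ⁺) ⊕ (x ⁻ ⊕ y ⁻)                        ≈⟨ ⊕-congʳ (⊕-congʳ (⁺-cong (QW*8 x))) ⟩
    (x ⁺ ⊕ y ⁺) ⊕ (x ⁻ ⊕ y ⁻)                                ∎

  -- Reduces the exchange form of QMV*2 to QW*2 under one outer negation.
  1⊕-1⊕-⊕ : ∀ x y z → (1# ⊕ x) ⊕ ((1# ⊕ y) ⊕ z)
                    ≈ ¬ ((¬ x ⇒ 1#) ⇒ ((¬ y ⇒ 1#) ⇒ ¬ z))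
  1⊕-1⊕-⊕ x y z = begin
    (1# ⊕ x) ⊕ ((1# ⊕ y) ⊕ z)                ≈⟨ ⊕-congʳ (⊕-comm 1# x) ⟩
    (x ⊕ 1#) ⊕ ((1# ⊕ y) ⊕ z)                ≈⟨ ⊕-congˡ (⊕-congʳ (⊕-comm 1# y)) ⟩
    (x ⊕ 1#) ⊕ ((y ⊕ 1#) ⊕ z)                ≈⟨ ⊕-congˡ (⊕-comm (y ⊕ 1#) z) ⟩
    (x ⊕ 1#) ⊕ (¬ z ⇒ (y ⊕ 1#))              ≈⟨ ⊕-congˡ (QW*7 (y ⊕ 1#) (¬ z)) ⟨
    (x ⊕ 1#) ⊕ ¬ ((y ⊕ 1#) ⇒ ¬ z)            ≈⟨ QW*1 ((y ⊕ 1#) ⇒ ¬ z) (x ⊕ 1#) ⟨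
    ((y ⊕ 1#) ⇒ ¬ z) ⇒ (x ⊕ 1#)              ≈⟨ QW*7 (x ⊕ 1#) ((y ⊕ 1#) ⇒ ¬ z) ⟨
    ¬ ((x ⊕ 1#) ⇒ ((y ⊕ 1#) ⇒ ¬ z))          ∎

  ⊕-1-assoc : ∀ x y z → (1# ⊕ x) ⊕ (y ⊕ (1# ⊕ z)) ≈ ((1# ⊕ x) ⊕ y) ⊕ (1# ⊕ z)
  ⊕-1-assoc x y z = begin
    (1# ⊕ x) ⊕ (y ⊕ (1# ⊕ z))                      ≈⟨ ⊕-congˡ (⊕-comm y (1# ⊕ z)) ⟩
    (1# ⊕ x) ⊕ ((1# ⊕ z) ⊕ y)                      ≈⟨ 1⊕-1⊕-⊕ x z y ⟩
    ¬ ((¬ x ⇒ 1#) ⇒ ((¬ z ⇒ 1#) ⇒ ¬ y))            ≈⟨ ¬-cong (QW*2 (¬ x) (¬ z) (¬ y)) ⟩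
    ¬ ((¬ z ⇒ 1#) ⇒ ((¬ x ⇒ 1#) ⇒ ¬ y))            ≈⟨ 1⊕-1⊕-⊕ z x y ⟨
    (1# ⊕ z) ⊕ ((1# ⊕ x) ⊕ y)                      ≈⟨ ⊕-comm (1# ⊕ z) ((1# ⊕ x) ⊕ y) ⟩
    ((1# ⊕ x) ⊕ y) ⊕ (1# ⊕ z)                      ∎

  g-isQuasiMV* : IsQuasiMV* S (g W)
  g-isQuasiMV* = record
    { ⊕-cong = Pre.⊕-cong
    ; -‿cong = Pre.-‿cong
    ; ⁺-cong = ⁺-cong
    ; ⁻-cong = ⁻-cong
    ; QMV*1  = ⊕-comm
    ; QMV*2  = ⊕-1-assoc
    ; QMV*3  = Pre.⊕-absorb-1
    ; QMV*4  = Pre.⊕-⊕0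
    ; QMV*5⁺ = λ x → Pre.⁺-⊕0 x , Pre.⊕0-⁺ x
    ; QMV*5⁻ = λ x → Pre.⁻-⊕0 x , Pre.⊕0-⁻ x
    ; QMV*6  = ⊕-parts
    ; QMV*7  = Pre.0≈-0
    ; QMV*8  = Pre.⊕-inverseʳ
    ; QMV*9  = ¬-distrib-⊕
    ; QMV*10 = QW*8
    ; QMV*11 = λ x y → trans (⁺-cong (¬¬-⇒ x (x ⊕ y)))
                 (trans (QW*9 x y) (sym (¬¬-⇒ (x ⁺) (x ⁺ ⊕ y ⁺))))
    ; QMV*12 = λ x y → trans (g-∨ x y) (trans (QW*10 x y) (sym (g-∨ y x)))
    ; QMV*13 = λ x y z → begin
                 x ∨ᵍ (y ∨ᵍ z)    ≈⟨ g-∨ x (y ∨ᵍ z) ⟩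
                 x ∨ (y ∨ᵍ z)     ≈⟨ ∨-cong refl (g-∨ y z) ⟩
                 x ∨ (y ∨ z)      ≈⟨ QW*11 x y z ⟩
                 (x ∨ y) ∨ z      ≈⟨ ∨-cong (g-∨ x y) refl ⟨
                 (x ∨ᵍ y) ∨ z     ≈⟨ g-∨ (x ∨ᵍ y) z ⟨
                 (x ∨ᵍ y) ∨ᵍ z    ∎
    ; QMV*14 = λ x y z → trans (⇒-congˡ (g-∨ y z))
                 (trans (QW*12 (¬ x) y z) (sym (g-∨ (x ⊕ y) (x ⊕ z))))
    }
    where module Pre = IsPreQuasiMV* g-isPreQuasiMV*

  f∘g : W*Equal S (f (g W)) W
  f∘g = record
    { ⇒-≈ = ¬¬-⇒
    ; ¬-≈ = λ x → refl
    ; ⁺-≈ = λ x → refl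
    ; ⁻-≈ = λ x → refl
    ; 1-≈ = refl
    }

-- The bijection between the two setoids of algebras.

module _ {S : Setoid c ℓ} where
  open Setoid S using (Carrier; trans)
  open MV*Equal
  open W*Equal

  -- The operation is changed first, at fixed arguments; the arguments then change inside `B`, by
  -- its congruence.
  f-cong : {A B : RawQuasiMV* Carrier} → IsQuasiMV* S B →
           MV*Equal S A B → W*Equal S (f A) (f B)
  f-cong isB p = record
    { ⇒-≈ = λ x y → trans (⊕-≈ p _ y) (IsQuasiMV*.⊕-cong isB (-‿≈ p x) (Setoid.refl S))
    ; ¬-≈ = -‿≈ p
    ; ⁺-≈ = ⁺-≈ p
    ; ⁻-≈ = ⁻-≈ p
    ; 1-≈ = 1-≈ p
    }

  g-cong : {V W : RawQuasiWajsberg* Carrier} → IsQuasiWajsberg* S W →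
           W*Equal S V W → MV*Equal S (g V) (g W)
  g-cong isW p = record
    { ⊕-≈ = λ x y → trans (⇒-≈ p _ y) (IsQuasiWajsberg*.⇒-cong isW (¬-≈ p x) (Setoid.refl S))
    ; -‿≈ = ¬-≈ p
    ; ⁺-≈ = ⁺-≈ p
    ; ⁻-≈ = ⁻-≈ p
    ; 0-≈ = trans (⇒-≈ p _ _) (IsQuasiWajsberg*.⇒-cong isW (1-≈ p) (1-≈ p))
    ; 1-≈ = 1-≈ p
    }

f-g-inverse : (S : Setoid c ℓ) → Inverse (QuasiMV*-setoid S) (QuasiWajsberg*-setoid S)
f-g-inverse S = record
  { to        = to
  ; from      = from
  ; to-cong   = λ {A} {B} → to-cong {A} {B}
  ; from-cong = λ {V} {W} → from-cong {V} {W}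
  -- The inverse laws start from an equality `p`: congruence carries it across, and the round trip
  -- then collapses.
  ; inverse   = (λ {W} {A} p → Setoid.trans (rawW*-setoid S) (to-cong {A} {from W} p)
                                 (QuasiWajsberg*Properties.f∘g (isQuasiWajsberg* W)))
              , (λ {A} {W} p → Setoid.trans (rawMV*-setoid S) (from-cong {W} {to A} p)
                                 (QuasiMV*Properties.g∘f (isQuasiMV* A)))
  }
  where
  open QuasiMV* using (isQuasiMV*)
  open QuasiWajsberg* using (isQuasiWajsberg*)

  to : QuasiMV* S → QuasiWajsberg* S
  -- Unification fills `raw` with `f` of the operations of `A`, so the final agreement with `f`
  -- holds by `≡.refl`; `from` works likewise.
  to A = record { isQuasiWajsberg* = QuasiMV*Properties.f-isQuasiWajsberg* (isQuasiMV* A) }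

  from : QuasiWajsberg* S → QuasiMV* S
  from W = record { isQuasiMV* = QuasiWajsberg*Properties.g-isQuasiMV* (isQuasiWajsberg* W) }

  to-cong : ∀ {A B} → MV*Equal S (QuasiMV*.raw A) (QuasiMV*.raw B) →
            W*Equal S (QuasiWajsberg*.raw (to A)) (QuasiWajsberg*.raw (to B))
  to-cong {B = B} = f-cong (isQuasiMV* B)

  from-cong : ∀ {V W} → W*Equal S (QuasiWajsberg*.raw V) (QuasiWajsberg*.raw W) →
              MV*Equal S (QuasiMV*.raw (from V)) (QuasiMV*.raw (from W))
  from-cong {W = W} = g-cong (isQuasiWajsberg* W)

theorem3p1 : ∀ {c ℓ : Level} (S : Setoid c ℓ) →
  ((A : RawQuasiMV* (Setoid.Carrier S)) → IsQuasiMV* S A →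
    IsQuasiWajsberg* S (f A) × MV*Equal S (g (f A)) A)
  ×
  ((W : RawQuasiWajsberg* (Setoid.Carrier S)) → IsQuasiWajsberg* S W →
    IsQuasiMV* S (g W) × W*Equal S (f (g W)) W)
  ×
  (Σ[ φ ∈ Inverse (QuasiMV*-setoid S) (QuasiWajsberg*-setoid S) ]
    ((A : QuasiMV* S) →
      QuasiWajsberg*.raw (Inverse.to φ A) ≡ f (QuasiMV*.raw A))
    ×
    ((W : QuasiWajsberg* S) →
      QuasiMV*.raw (Inverse.from φ W) ≡ g (QuasiWajsberg*.raw W)))
theorem3p1 S =
    (λ A isA → QuasiMV*Properties.f-isQuasiWajsberg* isA , QuasiMV*Properties.g∘f isA)
  , (λ W isW → QuasiWajsberg*Properties.g-isQuasiMV* isW , QuasiWajsberg*Properties.f∘g isW)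
  , f-g-inverse S , (λ A → ≡.refl) , (λ W → ≡.refl)
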